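{- Two states $x\in Q$, $y\in Q'$ of finitely branching regular nominal transition systems $(Q,\gamma)$, $(Q',\delta)$ are equivalent under local freshness semantics, i.e. $D(L(x))=D(L(y))$, if and only if they are behaviourally equivalent with respect to the graded semantics $({\mathbb{M}}^{\mathsf{loc}},\theta_1\cdot\alpha)$, i.e. $\gamma^{(n)}(x)=\delta^{(n)}(y)$ for all $n\in\mathbb{N}$.
   Context: Nominal sets: $\mathbb{A}$ countably infinite set of names, $G$ finite permutations of $\mathbb{A}$, $(a\,b)$ transpositions. Nominal set: set with $G$-action, every element with finite support; $a\#x$ iff $a\notin\mathsf{supp}(x)$; orbit-finite = finitely many orbits; equivariant maps commute with the action. $[\mathbb{A}]Z$: quotient of $\mathbb{A}\times Z$ by $(a,z)\sim(b,z')$ iff $(c\,a)\cdot z=(c\,b)\cdot z'$ for some fresh $c$, classes $\langle a\rangle z$. $\mathcal{P}_\omega$ finite powerset. $1=\{*\}$. Bar strings: $\overline{\mathbb{A}}=\mathbb{A}\cup\{|a\mid a\in\mathbb{A}\}$, $\pi\cdot|a=|\pi(a)$. $\equiv_\alpha$ on $\overline{\mathbb{A}}^*\times X$ ($\overline{\mathbb{A}}^*\times 1$ identified with bar strings): equivalence generated by $w\,|a\,v\equiv_\alpha w\,|b\,u$ whenever $\langle a\rangle v=\langle b\rangle u$ in $[\mathbb{A}](\overline{\mathbb{A}}^*\times X)$. $\mathsf{ub}$ removes bars ($|a\mapsto a$). For a set $L$ of $\alpha$-classes, $D(L)=\{\mathsf{ub}(w)\mid[w]_\alpha\in L\}$ (all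 representatives). Systems: $H_\omega X=\mathcal{P}_\omega(\mathbb{A}\times X)\times\mathcal{P}_\omega([\mathbb{A}]X)$. A finitely branching regular nominal transition system is an orbit-finite nominal set $Q$ with an equivariant $\gamma\colon Q\to H_\omega Q$; $q\xrightarrow{a}q'$ iff $(a,q')$ is in the first component of $\gamma(q)$, $q\xrightarrow{|a}q'$ iff $\langle a\rangle q'$ is in the second. Extend to bar strings as usual; $L(q)=\{[w]_\alpha\mid q\xrightarrow{w}q'\text{ for some }q'\}$. $M^{\mathsf{bar}}_1X=\mathcal{P}_\omega((\overline{\mathbb{A}}\times X)/{\equiv_\alpha})$ and $\alpha_X\colon H_\omega X\to M^{\mathsf{bar}}_1X$, $\alpha_X(S,T)=\{[ax]_\alpha\mid(a,x)\in S\}\cup\{[|a\,x]_\alpha\mid\langle a\rangle x\in T\}$. Graded nominal algebra for $T^{\mathsf{loc}}$: signature with pure $0$ (constant) and $+$ (binary), depth 0, free $\mathsf{pre}$ and bound $\mathsf{abs}$, unary of depth 1. Terms over a nominal set $X$: variables, $0$, $t+u$, $a.\mathsf{pre}(t)$, $\nu a.\mathsf{abs}(t)$; uniform depth: variables $0$, $0$ any depth, $+$ preserves, $\mathsf{pre},\mathsf{abs}$ add 1; $\mathsf{Term}_n(X)$ the nominal set of raw terms of uniform depth $n$. Axioms of $T^{\mathsf{loc}}$ (for each orbit-finite $Y$, $x,y,z\in Y$, $a\in\mathbb{A}$): $Y\vdash_0x+0=x$, $x+x=x$, $x+y=y+x$, $(x+y)+z=x+(y+z)$; $Y\vdash_1a.\mathsf{pre}(x+y)=a.\mathsf{pre}(x)+a.\mathsf{pre}(y)$;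 $\emptyset\vdash_1a.\mathsf{pre}(0)=0$; $Y\vdash_1\nu a.\mathsf{abs}(x+y)=\nu a.\mathsf{abs}(x)+\nu a.\mathsf{abs}(y)$; $\emptyset\vdash_1\nu a.\mathsf{abs}(0)=0$; $Y\vdash_1a.\mathsf{pre}(x)+\nu a.\mathsf{abs}(x)=\nu a.\mathsf{abs}(x)$. Derivable judgements: least set closed under (refl) $X\vdash_0x=x$; (symm); (trans); (cong) for each operation (same prefix name); (ax) instantiating an axiom $Y\vdash_mr=s$ as $X\vdash_{m+l}(\tau\cdot r)\sigma=(\tau\cdot s)\sigma$ for $\tau\in G$, $\sigma\colon Y\to\mathsf{Term}_l(X)$ with $X\vdash_l\pi\cdot\sigma(y)=\sigma(\pi\cdot y)$ derivable for all $\pi,y$ (substitution without renaming bound names); (perm) from $X\vdash_mt=(a\,b)\cdot u$, $a\ne b$, $a\#u$, infer $X\vdash_{m+1}\nu a.\mathsf{abs}(t)=\nu b.\mathsf{abs}(u)$. The graded monad ${\mathbb{M}}^{\mathsf{loc}}$ induced by $T^{\mathsf{loc}}$: $M^{\mathsf{loc}}_nX=\mathsf{Term}_n(X)/{\sim}$ ($\sim$ derivable equality, classes $[t]_n$); $M^{\mathsf{loc}}_nf([t]_n)=[t\sigma_f]_n$ with $\sigma_f(x)=f(x)$; $\eta_X(x)=[x]_0$; $\mu^{nk}_X([t]_n)=[t\sigma]_{n+k}$ for $t\in\mathsf{Term}_n(M^{\mathsf{loc}}_kX)$ and any $\sigma\colon M^{\mathsf{loc}}_kX\to\mathsf{Term}_k(X)$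 with $[\sigma(c)]_k=c$. $\theta_1\colon M^{\mathsf{bar}}_1X\to M^{\mathsf{loc}}_1X$ maps $\{[t_1]_\alpha,\dots,[t_k]_\alpha\}$ to $[t_1+\dots+t_k]_1$ ($[0]_1$ if empty), reading $ax$ as $a.\mathsf{pre}(x)$ and $|a\,x$ as $\nu a.\mathsf{abs}(x)$. For a coalgebra $\gamma\colon Q\to H_\omega Q$, the behaviour maps $\gamma^{(n)}\colon Q\to M^{\mathsf{loc}}_n1$ are $\gamma^{(0)}=M^{\mathsf{loc}}_0!\cdot\eta_Q$ and $\gamma^{(n+1)}=\mu^{1,n}_1\cdot M^{\mathsf{loc}}_1\gamma^{(n)}\cdot\theta_{1,Q}\cdot\alpha_Q\cdot\gamma$. -}

module Defs where

open import Level using (0ℓ)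
open import Data.Nat using (ℕ; zero; suc; _+_; _≟_)
open import Data.Unit using (⊤; tt)
open import Data.Empty using (⊥; ⊥-elim)
open import Data.Product using (Σ; ∃; ∃-syntax; _×_; _,_; proj₁; proj₂)
open import Data.List using (List; []; _∷_; _++_; map)
open import Data.List.Membership.Propositional using (_∈_; _∉_)
open import Data.List.Membership.Propositional.Properties using (∈-++⁺ˡ; ∈-++⁺ʳ)
open import Data.List.Relation.Unary.Any using (here; there)
open import Relation.Binary.PropositionalEquality using (_≡_; _≢_; refl; sym; trans; cong)
open import Relation.Nullary using (yes; no; ¬_)
open import Function.Bundles using (_⇔_)

Name : Set
Name = ℕ

record Perm : Set where
  field
    to      : Name → Name
    from    : Name → Name
    to-from : ∀ a → to (from a) ≡ a
    from-to : ∀ a → from (to a) ≡ a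
    dom     : List Name
    fixes   : ∀ a → a ∉ dom → to a ≡ a
open Perm public

idP : Perm
idP = record { to = λ a → a ; from = λ a → a ; to-from = λ _ → refl
             ; from-to = λ _ → refl ; dom = [] ; fixes = λ _ _ → refl }

_∘P_ : Perm → Perm → Perm
π ∘P ρ = record
  { to = λ a → to π (to ρ a)
  ; from = λ a → from ρ (from π a)
  ; to-from = λ a → trans (cong (to π) (to-from ρ (from π a))) (to-from π a)
  ; from-to = λ a → trans (cong (from ρ) (from-to π (to ρ a))) (from-to ρ a)
  ; dom = dom π ++ dom ρ
  ; fixes = λ a a∉ →
      trans (cong (to π) (fixes ρ a (λ a∈ → a∉ (∈-++⁺ʳ (dom π) a∈))))
            (fixes π a (λ a∈ → a∉ (∈-++⁺ˡ a∈)))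
  }

swapN : Name → Name → Name → Name
swapN a b c with c ≟ a
... | yes _ = b
... | no _ with c ≟ b
...   | yes _ = a
...   | no _ = c

swapN-invol : ∀ a b c → swapN a b (swapN a b c) ≡ c
swapN-invol a b c with c ≟ a
swapN-invol a b c | yes c≡a with b ≟ a
... | yes b≡a = trans b≡a (sym c≡a)
... | no _ with b ≟ b
...   | yes _ = sym c≡a
...   | no b≢b = ⊥-elim (b≢b refl)
swapN-invol a b c | no c≢a with c ≟ b
swapN-invol a b c | no c≢a | yes c≡b with a ≟ a
... | yes _ = sym c≡b
... | no a≢a = ⊥-elim (a≢a refl)
swapN-invol a b c | no c≢a | no c≢b with c ≟ a
... | yes c≡a = ⊥-elim (c≢a c≡a)
... | no _ with c ≟ b
...   | yes c≡b = ⊥-elim (c≢b c≡b)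
...   | no _ = refl

swapN-fix : ∀ a b c → c ∉ (a ∷ b ∷ []) → swapN a b c ≡ c
swapN-fix a b c c∉ with c ≟ a
... | yes c≡a = ⊥-elim (c∉ (here c≡a))
... | no _ with c ≟ b
...   | yes c≡b = ⊥-elim (c∉ (there (here c≡b)))
...   | no _ = refl

swapP : Name → Name → Perm
swapP a b = record
  { to = swapN a b ; from = swapN a b
  ; to-from = swapN-invol a b ; from-to = swapN-invol a b
  ; dom = a ∷ b ∷ [] ; fixes = swapN-fix a b }

Supports : {X : Set} → (Perm → X → X) → List Name → X → Set
Supports act s x = ∀ π → (∀ a → a ∈ s → to π a ≡ a) → act π x ≡ x

-- a # x  iff  a ∉ supp(x), where supp(x) is the least finite support,
-- i.e. iff some finite support of x does not contain a.
Fresh : {X : Set} → (Perm → X → X) → Name → X → Set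
Fresh act a x = ∃[ s ] (Supports act s x × a ∉ s)

record NomSet : Set₁ where
  field
    Car     : Set
    act     : Perm → Car → Car
    act-id  : ∀ x → act idP x ≡ x
    act-∘   : ∀ π ρ x → act (π ∘P ρ) x ≡ act π (act ρ x)
    act-ext : ∀ π ρ → (∀ a → to π a ≡ to ρ a) → ∀ x → act π x ≡ act ρ x
    finSupp : ∀ x → ∃[ s ] Supports act s x
open NomSet public

OrbitFinite : NomSet → Set
OrbitFinite X = ∃[ os ] (∀ x → ∃[ o ] (o ∈ os × ∃[ π ] (act X π o ≡ x)))

record OFNomSet : Set₁ where
  field
    nom : NomSet
    orbFin : OrbitFinite nom
open OFNomSet public

OneN : NomSet
OneN = record { Car = ⊤ ; act = λ _ x → x ; act-id = λ _ → refl
              ; act-∘ = λ _ _ _ → refl ; act-ext = λ _ _ _ _ → refl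
              ; finSupp = λ x → [] , (λ _ _ → refl) }

EmptyN : NomSet
EmptyN = record { Car = ⊥ ; act = λ _ x → x ; act-id = λ _ → refl
                ; act-∘ = λ _ _ _ → refl ; act-ext = λ _ _ _ _ → refl
                ; finSupp = λ () }

EmptyOF : OFNomSet
EmptyOF = record { nom = EmptyN ; orbFin = [] , λ () }

AbsEq : {Z : Set} → (Perm → Z → Z) → Name → Z → Name → Z → Set
AbsEq act a z b z' =
  ∃[ c ] (c ≢ a × c ≢ b × Fresh act c z × Fresh act c z'
          × act (swapP c a) z ≡ act (swapP c b) z')

-- Finitely branching regular nominal transition systems
--
-- An element of H_ω Q = P_ω(𝔸 × Q) × P_ω([𝔸]Q) is represented by a pair of
-- finite lists; a pair (a , x) in the second list represents ⟨a⟩x.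

HRep : Set → Set
HRep Q = List (Name × Q) × List (Name × Q)

module _ (Q : NomSet) where
  private
    A = Car Q
    _·_ = act Q

  actH : Perm → HRep A → HRep A
  actH π (S , T) = map (λ p → to π (proj₁ p) , π · proj₂ p) S
                 , map (λ p → to π (proj₁ p) , π · proj₂ p) T

  _∈Abs_ : Name × A → List (Name × A) → Set
  (a , x) ∈Abs T = ∃[ p ] (p ∈ T × AbsEq (act Q) (proj₁ p) (proj₂ p) a x)

  _≈H_ : HRep A → HRep A → Set
  (S , T) ≈H (S' , T') = (∀ p → (p ∈ S ⇔ p ∈ S')) × (∀ p → (p ∈Abs T ⇔ p ∈Abs T'))

record FBRNTS : Set₁ where
  field
    St      : OFNomSet
    γ       : Car (nom St) → HRep (Car (nom St))
    γ-equiv : ∀ π q → _≈H_ (nom St) (γ (act (nom St) π q)) (actH (nom St) π (γ q))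
open FBRNTS public

data Bar : Set where
  nm : Name → Bar
  br : Name → Bar

actBar : Perm → Bar → Bar
actBar π (nm a) = nm (to π a)
actBar π (br a) = br (to π a)

actBS : Perm → List Bar → List Bar
actBS π w = map (actBar π) w

ub : List Bar → List Name
ub = map f
  where f : Bar → Name
        f (nm a) = a
        f (br a) = a

data _≡α_ : List Bar → List Bar → Set where
  α-refl  : ∀ w → w ≡α w
  α-sym   : ∀ {w v} → w ≡α v → v ≡α w
  α-trans : ∀ {w v u} → w ≡α v → v ≡α u → w ≡α u
  α-step  : ∀ w a v b u → AbsEq actBS a v b u → (w ++ br a ∷ v) ≡α (w ++ br b ∷ u)

module _ (𝒬 : FBRNTS) where
  private
    A = Car (nom (St 𝒬))

  data Step : A → Bar → A → Set where
    step-nm : ∀ {q a q'} → (a , q') ∈ proj₁ (γ 𝒬 q) → Step q (nm a) q'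
    step-br : ∀ {q a q'} → _∈Abs_ (nom (St 𝒬)) (a , q') (proj₂ (γ 𝒬 q)) → Step q (br a) q'

  data Path : A → List Bar → A → Set where
    p-nil  : ∀ {q} → Path q [] q
    p-cons : ∀ {q l q' w q''} → Step q l q' → Path q' w q'' → Path q (l ∷ w) q''

  InL : A → List Bar → Set
  InL q w = ∃[ v ] ((∃[ q' ] Path q v q') × w ≡α v)

  InD : A → List Name → Set
  InD q u = ∃[ w ] (InL q w × ub w ≡ u)

data Term (X : Set) : ℕ → Set where
  var  : X → Term X 0
  zer  : ∀ {n} → Term X n
  plus : ∀ {n} → Term X n → Term X n → Term X n
  pre  : ∀ {n} → Name → Term X n → Term X (suc n)
  abs  : ∀ {n} → Name → Term X n → Term X (suc n)

actT : {X : Set} → (Perm → X → X) → Perm → ∀ {n} → Term X n → Term X n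
actT ax π (var x)    = var (ax π x)
actT ax π zer        = zer
actT ax π (plus t u) = plus (actT ax π t) (actT ax π u)
actT ax π (pre a t)  = pre (to π a) (actT ax π t)
actT ax π (abs a t)  = abs (to π a) (actT ax π t)

-- substitution (no renaming of bound names)
subst : {X Y : Set} {l : ℕ} → (Y → Term X l) → ∀ {m} → Term Y m → Term X (m + l)
subst σ (var y)    = σ y
subst σ zer        = zer
subst σ (plus t u) = plus (subst σ t) (subst σ u)
subst σ (pre a t)  = pre a (subst σ t)
subst σ (abs a t)  = abs a (subst σ t)

data Ax : (Y : OFNomSet) → (m : ℕ) → Term (Car (nom Y)) m → Term (Car (nom Y)) m → Set₁ where
  ax-unit  : ∀ {Y} (x : Car (nom Y)) → Ax Y 0 (plus (var x) zer) (var x)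
  ax-idem  : ∀ {Y} (x : Car (nom Y)) → Ax Y 0 (plus (var x) (var x)) (var x)
  ax-comm  : ∀ {Y} (x y : Car (nom Y)) → Ax Y 0 (plus (var x) (var y)) (plus (var y) (var x))
  ax-assoc : ∀ {Y} (x y z : Car (nom Y)) →
             Ax Y 0 (plus (plus (var x) (var y)) (var z)) (plus (var x) (plus (var y) (var z)))
  ax-pre+  : ∀ {Y} (a : Name) (x y : Car (nom Y)) →
             Ax Y 1 (pre a (plus (var x) (var y))) (plus (pre a (var x)) (pre a (var y)))
  ax-pre0  : (a : Name) → Ax EmptyOF 1 (pre a zer) zer
  ax-abs+  : ∀ {Y} (a : Name) (x y : Car (nom Y)) →
             Ax Y 1 (abs a (plus (var x) (var y))) (plus (abs a (var x)) (abs a (var y)))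
  ax-abs0  : (a : Name) → Ax EmptyOF 1 (abs a zer) zer
  ax-preabs : ∀ {Y} (a : Name) (x : Car (nom Y)) →
             Ax Y 1 (plus (pre a (var x)) (abs a (var x))) (abs a (var x))

data Der (X : NomSet) : (m : ℕ) → Term (Car X) m → Term (Car X) m → Set₁ where
  d-refl  : ∀ x → Der X 0 (var x) (var x)
  d-symm  : ∀ {m t u} → Der X m t u → Der X m u t
  d-trans : ∀ {m t u v} → Der X m t u → Der X m u v → Der X m t v
  d-cong0 : ∀ {m} → Der X m zer zer
  d-cong+ : ∀ {m t t' u u'} → Der X m t t' → Der X m u u' → Der X m (plus t u) (plus t' u')
  d-congpre : ∀ {m t t'} a → Der X m t t' → Der X (suc m) (pre a t) (pre a t')
  d-congabs : ∀ {m t t'} a → Der X m t t' → Der X (suc m) (abs a t) (abs a t')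
  d-ax    : ∀ (Y : OFNomSet) {m l} {r s : Term (Car (nom Y)) m} → Ax Y m r s →
            (τ : Perm) (σ : Car (nom Y) → Term (Car X) l) →
            (∀ π y → Der X l (actT (act X) π (σ y)) (σ (act (nom Y) π y))) →
            Der X (m + l) (subst σ (actT (act (nom Y)) τ r)) (subst σ (actT (act (nom Y)) τ s))
  d-perm  : ∀ {m} {t u : Term (Car X) m} (a b : Name) →
            Der X m t (actT (act X) (swapP a b) u) → a ≢ b → Fresh (λ π → actT (act X) π {m}) a u →
            Der X (suc m) (abs a t) (abs b u)

sumT : {X : Set} {n : ℕ} → List (Term X n) → Term X n
sumT []           = zer
sumT (t ∷ [])     = t
sumT (t ∷ u ∷ ts) = plus t (sumT (u ∷ ts))

module _ (𝒬 : FBRNTS) where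
  private
    A = Car (nom (St 𝒬))

  -- θ_{1,Q} (α_Q (γ q)) as a representing term in Term_1(Q)
  θαγ : A → Term A 1
  θαγ q = sumT (map (λ p → pre (proj₁ p) (var (proj₂ p))) (proj₁ (γ 𝒬 q))
             ++ map (λ p → abs (proj₁ p) (var (proj₂ p))) (proj₂ (γ 𝒬 q)))

  -- beh n q is a representative of γ^(n)(q) ∈ M^loc_n 1
  beh : (n : ℕ) → A → Term ⊤ n
  beh zero    q = var tt
  beh (suc n) q = subst (beh n) (θαγ q)

{-# OPTIONS --safe #-}

-- Order bar strings by letting nm a ⊑ br a letterwise, and modulo ≡α.  Both
-- sides of the equivalence say that every word of one term lies below some
-- word of the other, and conversely.
--
-- For derivability, the axiom pre a x + abs a x = abs a x is exactly
-- the step nm a ⊑ br a, and linearity of the operations splits a term into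
-- the sum of its words.
--
-- For local freshness, rename a word v so that its bound names are pairwise
-- distinct and avoid all names of the other term.  If ub v = ub w for some w
-- α-equivalent to a word of the other term, then a position barred in v
-- carries a name that is neither free in w nor occurs earlier in w, so it is
-- barred in w as well, that is, v ⊑ w.
module Submission where

open import Defs
open import Data.Nat using (ℕ; zero; suc; _+_; _≤_; s≤s; _≟_)
open import Data.Nat.ListAction using (sum)
open import Data.Nat.Properties using (≤-trans; m≤m+n; m≤n+m; 1+n≰n; +-identityʳ; +-suc)
open import Data.Fin using (Fin)
open import Data.Fin.Patterns using (0F; 1F; 2F)
open import Data.Unit using (⊤; tt)
open import Data.Product using (∃-syntax; _×_; _,_; proj₁; proj₂)
open import Data.Sum using (inj₁; inj₂)
open import Data.List using (List; []; _∷_; _++_; map; length; concatMap; allFin; cartesianProduct)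
open import Data.List.Properties using (map-++; length-map; length-++; ∷-injective)
open import Data.List.Membership.Propositional using (_∈_; _∉_; lose)
open import Data.List.Membership.Propositional.Properties
open import Data.List.Membership.DecPropositional _≟_ using (_∈?_)
open import Data.List.Relation.Unary.Any using (here; there)
open import Data.List.Relation.Binary.Pointwise using (Pointwise; []; _∷_)
import Data.List.Relation.Binary.Pointwise as Pointwise
open import Data.Vec using (Vec; []; _∷_; toList)
import Data.Vec as Vec
import Data.Vec.Properties as Vecₚ
open import Function using (_∘_; id)
open import Function.Bundles using (_⇔_; mk⇔; Equivalence)
open import Relation.Binary.PropositionalEquality as ≡ using (_≡_; _≢_; refl; sym; trans; cong; cong₂)
open import Relation.Nullary using (¬_; yes; no; contradiction)

-- Names and permutations

∈⇒≤sum : ∀ {a} xs → a ∈ xs → a ≤ sum xs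
∈⇒≤sum (x ∷ xs) (here refl) = m≤m+n x (sum xs)
∈⇒≤sum (x ∷ xs) (there a∈)  = ≤-trans (∈⇒≤sum xs a∈) (m≤n+m (sum xs) x)

fresh : List Name → Name
fresh xs = suc (sum xs)

fresh-∉ : ∀ xs → fresh xs ∉ xs
fresh-∉ xs f∈ = 1+n≰n (∈⇒≤sum xs f∈)

∉-∷ˡ : ∀ {a b : Name} {xs} → a ∉ b ∷ xs → a ≢ b
∉-∷ˡ a∉ = a∉ ∘ here

∉-++ˡ : ∀ {a : Name} {xs ys} → a ∉ xs ++ ys → a ∉ xs
∉-++ˡ a∉ = a∉ ∘ ∈-++⁺ˡ

∉-++ʳ : ∀ {a : Name} xs {ys} → a ∉ xs ++ ys → a ∉ ys
∉-++ʳ xs a∉ = a∉ ∘ ∈-++⁺ʳ xs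

swapN-left : ∀ a b → swapN a b a ≡ b
swapN-left a b with a ≟ a
... | yes _   = refl
... | no  a≢a = contradiction refl a≢a

swapN-right : ∀ a b → swapN a b b ≡ a
swapN-right a b with b ≟ a
... | yes b≡a = b≡a
... | no  _ with b ≟ b
...   | yes _   = refl
...   | no  b≢b = contradiction refl b≢b

swapN-other : ∀ {a b x} → x ≢ a → x ≢ b → swapN a b x ≡ x
swapN-other x≢a x≢b = swapN-fix _ _ _ λ
  { (here x≡a)         → x≢a x≡a
  ; (there (here x≡b)) → x≢b x≡b }

swapN-fixes : ∀ {a b} xs → a ∉ xs → b ∉ xs → ∀ x → x ∈ xs → swapN a b x ≡ x
swapN-fixes xs a∉ b∉ x x∈ = swapN-other (λ { refl → a∉ x∈ }) (λ { refl → b∉ x∈ })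

to-injective : ∀ π {a b} → to π a ≡ to π b → a ≡ b
to-injective π {a} {b} eq = trans (sym (from-to π a)) (trans (cong (from π) eq) (from-to π b))

swapN-conj : ∀ π a b x → swapN (to π a) (to π b) (to π x) ≡ to π (swapN a b x)
swapN-conj π a b x with x ≟ a
... | yes refl = swapN-left (to π x) (to π b)
... | no x≢a with x ≟ b
...   | yes refl = swapN-right (to π a) (to π x)
...   | no x≢b   = swapN-other (x≢a ∘ to-injective π) (x≢b ∘ to-injective π)

-- Bar strings

ub-act : ∀ π v → ub (actBS π v) ≡ map (to π) (ub v)
ub-act π []         = refl
ub-act π (nm a ∷ v) = cong (to π a ∷_) (ub-act π v)
ub-act π (br a ∷ v) = cong (to π a ∷_) (ub-act π v)

∈-ub-act : ∀ π {a} v → a ∈ ub v → to π a ∈ ub (actBS π v)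
∈-ub-act π v a∈ = ≡.subst (_ ∈_) (sym (ub-act π v)) (∈-map⁺ (to π) a∈)

∉-ub-act : ∀ π {a} v → a ∉ ub v → to π a ∉ ub (actBS π v)
∉-ub-act π v a∉ πa∈ with ∈-map⁻ (to π) (≡.subst (_ ∈_) (ub-act π v) πa∈)
... | b , b∈ , eq = a∉ (≡.subst (_∈ ub v) (sym (to-injective π eq)) b∈)

actBS-cong : ∀ π ρ v → (∀ a → a ∈ ub v → to π a ≡ to ρ a) → actBS π v ≡ actBS ρ v
actBS-cong π ρ []         eq = refl
actBS-cong π ρ (nm a ∷ v) eq =
  cong₂ _∷_ (cong nm (eq a (here refl))) (actBS-cong π ρ v (λ b → eq b ∘ there))
actBS-cong π ρ (br a ∷ v) eq =
  cong₂ _∷_ (cong br (eq a (here refl))) (actBS-cong π ρ v (λ b → eq b ∘ there))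

actBS-id : ∀ v → actBS idP v ≡ v
actBS-id []         = refl
actBS-id (nm a ∷ v) = cong (nm a ∷_) (actBS-id v)
actBS-id (br a ∷ v) = cong (br a ∷_) (actBS-id v)

actBS-∘ : ∀ π ρ v → actBS (π ∘P ρ) v ≡ actBS π (actBS ρ v)
actBS-∘ π ρ []         = refl
actBS-∘ π ρ (nm a ∷ v) = cong (_ ∷_) (actBS-∘ π ρ v)
actBS-∘ π ρ (br a ∷ v) = cong (_ ∷_) (actBS-∘ π ρ v)

actBS-supported : ∀ v → Supports actBS (ub v) v
actBS-supported v π fixes = trans (actBS-cong π idP v fixes) (actBS-id v)

actBS-swap-invol : ∀ a b v → actBS (swapP a b) (actBS (swapP a b) v) ≡ v
actBS-swap-invol a b v =
  trans (sym (actBS-∘ (swapP a b) (swapP a b) v))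
        (trans (actBS-cong _ idP v (λ x _ → swapN-invol a b x)) (actBS-id v))

actBS-swap-conj : ∀ π a b v →
  actBS (swapP (to π a) (to π b)) (actBS π v) ≡ actBS π (actBS (swapP a b) v)
actBS-swap-conj π a b v =
  trans (sym (actBS-∘ (swapP (to π a) (to π b)) π v))
        (trans (actBS-cong _ (π ∘P swapP a b) v (λ x _ → swapN-conj π a b x))
               (actBS-∘ π (swapP a b) v))

-- Every support of `v` contains all its names: if `c` lay outside a support but in `v`, swapping it
-- with some `d` outside both would fix `v` and yet put `d` into it.
fresh⇒∉ub : ∀ {c v} → Fresh actBS c v → c ∉ ub v
fresh⇒∉ub {c} {v} (s , supp , c∉s) c∈ = d∉ub (≡.subst (_∈ ub v) (swapN-left c d) swapped)
  where
    d = fresh (s ++ ub v)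
    d∉s = ∉-++ˡ {xs = s} (fresh-∉ (s ++ ub v))
    d∉ub = ∉-++ʳ s (fresh-∉ (s ++ ub v))
    swapped : swapN c d c ∈ ub v
    swapped = ≡.subst (λ w → swapN c d c ∈ ub w) (supp (swapP c d) (swapN-fixes s c∉s d∉s))
                      (∈-ub-act (swapP c d) v c∈)

∉ub⇒fresh : ∀ {c v} → c ∉ ub v → Fresh actBS c v
∉ub⇒fresh {v = v} c∉ = ub v , actBS-supported v , c∉

-- α-equivalence

AbsEq-sym : ∀ {Z : Set} {ac : Perm → Z → Z} {a z b z'} → AbsEq ac a z b z' → AbsEq ac b z' a z
AbsEq-sym (c , c≢a , c≢b , c#z , c#z' , eq) = c , c≢b , c≢a , c#z' , c#z , sym eq

AbsEq-refl : ∀ (X : NomSet) a x → AbsEq (act X) a x a x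
AbsEq-refl X a x with finSupp X x
... | s , supp = fresh (a ∷ s) , c≢a , c≢a , c#x , c#x , refl
  where
    c≢a = ∉-∷ˡ (fresh-∉ (a ∷ s))
    c#x = s , supp , fresh-∉ (a ∷ s) ∘ there

α-cong : ∀ l {v w} → v ≡α w → (l ∷ v) ≡α (l ∷ w)
α-cong l (α-refl v)           = α-refl (l ∷ v)
α-cong l (α-sym p)            = α-sym (α-cong l p)
α-cong l (α-trans p q)        = α-trans (α-cong l p) (α-cong l q)
α-cong l (α-step w a v b u e) = α-step (l ∷ w) a v b u e

AbsEq-act : ∀ π {a v b u} → AbsEq actBS a v b u →
            AbsEq actBS (to π a) (actBS π v) (to π b) (actBS π u)
AbsEq-act π {a} {v} {b} {u} (c , c≢a , c≢b , c#v , c#u , eq) =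
  to π c , c≢a ∘ to-injective π , c≢b ∘ to-injective π ,
  ∉ub⇒fresh (∉-ub-act π v (fresh⇒∉ub c#v)) ,
  ∉ub⇒fresh (∉-ub-act π u (fresh⇒∉ub c#u)) ,
  trans (actBS-swap-conj π c a v) (trans (cong (actBS π) eq) (sym (actBS-swap-conj π c b u)))

α-act : ∀ π {v w} → v ≡α w → actBS π v ≡α actBS π w
α-act π (α-refl v)    = α-refl (actBS π v)
α-act π (α-sym p)     = α-sym (α-act π p)
α-act π (α-trans p q) = α-trans (α-act π p) (α-act π q)
α-act π (α-step w a v b u e) =
  ≡.subst₂ _≡α_ (sym (map-++ (actBar π) w (br a ∷ v))) (sym (map-++ (actBar π) w (br b ∷ u)))
    (α-step (actBS π w) (to π a) (actBS π v) (to π b) (actBS π u) (AbsEq-act π e))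

α-length : ∀ {v w} → v ≡α w → length v ≡ length w
α-length (α-refl v)    = refl
α-length (α-sym p)     = sym (α-length p)
α-length (α-trans p q) = trans (α-length p) (α-length q)
α-length (α-step w a v b u (c , _ , _ , _ , _ , eq)) =
  trans (length-++ w) (trans (cong (λ n → length w + suc n) |v|≡|u|) (sym (length-++ w)))
  where
    |v|≡|u| : length v ≡ length u
    |v|≡|u| = trans (sym (length-map _ v)) (trans (cong length eq) (length-map _ u))

α-rename : ∀ c a v → c ∉ ub v → (br a ∷ v) ≡α (br c ∷ actBS (swapP c a) v)
α-rename c a v c∉ = α-step [] a v c v' (d , d≢a , d≢c , ∉ub⇒fresh d∉v , ∉ub⇒fresh d∉v' , eq)
  where
    v' = actBS (swapP c a) v
    avoid = a ∷ c ∷ ub v ++ ub v'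
    d = fresh avoid
    d≢a = ∉-∷ˡ (fresh-∉ avoid)
    d≢c = ∉-∷ˡ (fresh-∉ avoid ∘ there)
    d∉v = ∉-++ˡ {xs = ub v} (fresh-∉ avoid ∘ there ∘ there)
    d∉v' = ∉-++ʳ (ub v) (fresh-∉ avoid ∘ there ∘ there)
    -- Neither `c` nor `d` occurs in `v`, so renaming `a` to `d` directly or by way of `c` has the
    -- same effect there.
    pointwise : ∀ x → x ∈ ub v → swapN d a x ≡ swapN d c (swapN c a x)
    pointwise x x∈ with x ≟ a
    ... | yes refl = trans (swapN-right d x)
                       (sym (trans (cong (swapN d c) (swapN-right c x)) (swapN-right d c)))
    ... | no x≢a   = trans (swapN-other x≢d x≢a)
                       (sym (trans (cong (swapN d c) (swapN-other x≢c x≢a)) (swapN-other x≢d x≢c)))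
      where
        x≢c : x ≢ c
        x≢c refl = c∉ x∈
        x≢d : x ≢ d
        x≢d x≡d = d∉v (≡.subst (_∈ ub v) x≡d x∈)
    eq : actBS (swapP d a) v ≡ actBS (swapP d c) v'
    eq = trans (actBS-cong (swapP d a) (swapP d c ∘P swapP c a) v pointwise)
               (actBS-∘ (swapP d c) (swapP c a) v)

-- Free names and clean representatives.

data Free (c : Name) : List Bar → Set where
  free-here : ∀ {v} → Free c (nm c ∷ v)
  free-nm   : ∀ {a v} → Free c v → Free c (nm a ∷ v)
  free-br   : ∀ {a v} → c ≢ a → Free c v → Free c (br a ∷ v)

free⇒∈ub : ∀ {c v} → Free c v → c ∈ ub v
free⇒∈ub free-here     = here refl
free⇒∈ub (free-nm f)   = there (free⇒∈ub f)
free⇒∈ub (free-br _ f) = there (free⇒∈ub f)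

free-act : ∀ π {c v} → Free c v → Free (to π c) (actBS π v)
free-act π free-here       = free-here
free-act π (free-nm f)     = free-nm (free-act π f)
free-act π (free-br c≢a f) = free-br (c≢a ∘ to-injective π) (free-act π f)

free-abs : ∀ w {a v b u x} → AbsEq actBS a v b u → Free x (w ++ br a ∷ v) → Free x (w ++ br b ∷ u)
free-abs (nm _ ∷ w) e free-here       = free-here
free-abs (nm _ ∷ w) e (free-nm f)     = free-nm (free-abs w e f)
free-abs (br _ ∷ w) e (free-br x≢ f)  = free-br x≢ (free-abs w e f)
free-abs [] {a} {v} {b} {u} {x} (c , c≢a , c≢b , c#v , c#u , eq) (free-br x≢a f) =
  free-br x≢b (≡.subst (λ y → Free y u) (swapN-other x≢c x≢b) freeᵤ)
  where
    x≢c : x ≢ c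
    x≢c refl = fresh⇒∉ub c#v (free⇒∈ub f)
    -- The common string `actBS (swapP c a) v` is swapped back to `u`. Were `x` equal to `b`, this
    -- would make `c` free in `u`, against its freshness.
    freeᵤ : Free (swapN c b x) u
    freeᵤ = ≡.subst₂ Free (cong (swapN c b) (swapN-other x≢c x≢a))
              (trans (cong (actBS (swapP c b)) eq) (actBS-swap-invol c b u))
              (free-act (swapP c b) (free-act (swapP c a) f))
    x≢b : x ≢ b
    x≢b refl = fresh⇒∉ub c#u (free⇒∈ub (≡.subst (λ y → Free y u) (swapN-right c x) freeᵤ))

free-α : ∀ {x v w} → v ≡α w → (Free x v → Free x w) × (Free x w → Free x v)
free-α (α-refl v)    = id , id
free-α (α-sym p)     = proj₂ (free-α p) , proj₁ (free-α p)
free-α (α-trans p q) = proj₁ (free-α q) ∘ proj₁ (free-α p) , proj₂ (free-α p) ∘ proj₂ (free-α q)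
free-α (α-step w a v b u e) = free-abs w e , free-abs w (AbsEq-sym e)

-- Every barred name lies outside P and differs from all names before it.
data Clean : List Name → List Bar → Set where
  []       : ∀ {P} → Clean P []
  clean-nm : ∀ {P a v} → Clean (a ∷ P) v → Clean P (nm a ∷ v)
  clean-br : ∀ {P a v} → a ∉ P → Clean (a ∷ P) v → Clean P (br a ∷ v)

-- Each bar is renamed to a name fresh for `P` and for the rest of the string. The renamings are
-- accumulated in `π`, since the renamed tail is not a subterm and the recursion has to descend
-- along the original `v`.
cleanse-act : ∀ π P v → ∃[ v' ] (Clean P v' × actBS π v ≡α v')
cleanse-act π P []         = [] , [] , α-refl []
cleanse-act π P (nm a ∷ v) with cleanse-act π (to π a ∷ P) v
... | v' , cl , e = nm (to π a) ∷ v' , clean-nm cl , α-cong _ e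
cleanse-act π P (br a ∷ v) with fresh (P ++ ub (actBS π v)) | fresh-∉ (P ++ ub (actBS π v))
... | c | c∉ with cleanse-act (swapP c (to π a) ∘P π) (c ∷ P) v
...   | v' , cl , e =
  br c ∷ v' , clean-br (∉-++ˡ c∉) cl ,
  α-trans (α-rename c (to π a) (actBS π v) (∉-++ʳ P c∉))
          (α-cong (br c) (≡.subst (_≡α v') (actBS-∘ (swapP c (to π a)) π v) e))

cleanse : ∀ P v → ∃[ v' ] (Clean P v' × v ≡α v')
cleanse P v with cleanse-act idP P v
... | v' , cl , e = v' , cl , ≡.subst (_≡α v') (actBS-id v) e

-- `P` only grows along the string, so a name of `P` is never barred and no occurrence of it can be
-- bound.
clean-∈ub⇒free : ∀ {P c v} → Clean P v → c ∈ P → c ∈ ub v → Free c v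
clean-∈ub⇒free (clean-nm cl)     c∈P (here refl) = free-here
clean-∈ub⇒free (clean-nm cl)     c∈P (there c∈)  = free-nm (clean-∈ub⇒free cl (there c∈P) c∈)
clean-∈ub⇒free (clean-br a∉P cl) c∈P (here refl) = contradiction c∈P a∉P
clean-∈ub⇒free (clean-br a∉P cl) c∈P (there c∈)  =
  free-br (λ { refl → a∉P c∈P }) (clean-∈ub⇒free cl (there c∈P) c∈)

-- Unlike in `α-rename`, `c` may occur bound in `v`. Cleansing `v` against `c` removes these
-- occurrences, and is undone after the renaming.
α-rename-free : ∀ c a v → ¬ Free c v → (br a ∷ v) ≡α (br c ∷ actBS (swapP c a) v)
α-rename-free c a v c∉ with cleanse (c ∷ []) v
... | v' , cl , e =
  α-trans (α-cong (br a) e)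
    (α-trans (α-rename c a v' (c∉ ∘ proj₂ (free-α e) ∘ clean-∈ub⇒free cl (here refl)))
             (α-cong (br c) (α-act (swapP c a) (α-sym e))))

-- The order on bar strings

data _⊑ᵇ_ : Bar → Bar → Set where
  ⊑ᵇ-refl : ∀ {l} → l ⊑ᵇ l
  nm⊑br   : ∀ {a} → nm a ⊑ᵇ br a

_⊑_ : List Bar → List Bar → Set
_⊑_ = Pointwise _⊑ᵇ_

⊑-refl : ∀ {v} → v ⊑ v
⊑-refl = Pointwise.refl ⊑ᵇ-refl

⊑ᵇ-trans : ∀ {k l m} → k ⊑ᵇ l → l ⊑ᵇ m → k ⊑ᵇ m
⊑ᵇ-trans ⊑ᵇ-refl q       = q
⊑ᵇ-trans nm⊑br   ⊑ᵇ-refl = nm⊑br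

⊑-trans : ∀ {u v w} → u ⊑ v → v ⊑ w → u ⊑ w
⊑-trans = Pointwise.transitive ⊑ᵇ-trans

⊑-ub : ∀ {v w} → v ⊑ w → ub v ≡ ub w
⊑-ub []                       = refl
⊑-ub (_∷_ {nm _} ⊑ᵇ-refl p)   = cong (_ ∷_) (⊑-ub p)
⊑-ub (_∷_ {br _} ⊑ᵇ-refl p)   = cong (_ ∷_) (⊑-ub p)
⊑-ub (nm⊑br ∷ p)              = cong (_ ∷_) (⊑-ub p)

⊑ᵇ-act : ∀ π {k l} → k ⊑ᵇ l → actBar π k ⊑ᵇ actBar π l
⊑ᵇ-act π ⊑ᵇ-refl = ⊑ᵇ-refl
⊑ᵇ-act π nm⊑br   = nm⊑br

⊑-act : ∀ π {v w} → v ⊑ w → actBS π v ⊑ actBS π w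
⊑-act π p = Pointwise.map⁺ (actBar π) (actBar π) (Pointwise.map (⊑ᵇ-act π) p)

-- `P` bounds the free names of `w`. Passing a letter may free that name in the tail of `w`, and
-- `Clean` adds exactly that name to `P`.
clean⇒⊑ : ∀ {P} v w → Clean P v → ub v ≡ ub w → (∀ c → Free c w → c ∈ P) → v ⊑ w
clean⇒⊑ []         []         cl eq fr = []
clean⇒⊑ (nm a ∷ v) (nm b ∷ w) (clean-nm cl) eq fr with ∷-injective eq
... | refl , eq' = ⊑ᵇ-refl ∷ clean⇒⊑ v w cl eq' (λ c → there ∘ fr c ∘ free-nm)
clean⇒⊑ (nm a ∷ v) (br b ∷ w) (clean-nm cl) eq fr with ∷-injective eq
... | refl , eq' = nm⊑br ∷ clean⇒⊑ v w cl eq' free-tail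
  where
    free-tail : ∀ c → Free c w → c ∈ a ∷ _
    free-tail c f with c ≟ a
    ... | yes c≡a = here c≡a
    ... | no  c≢a = there (fr c (free-br c≢a f))
-- The only combination that would violate the order: a plain head of `w` is free, hence in `P`,
-- where no barred name of `v` lies.
clean⇒⊑ (br a ∷ v) (nm b ∷ w) (clean-br a∉P cl) eq fr with ∷-injective eq
... | refl , eq' = contradiction (fr a free-here) a∉P
clean⇒⊑ (br a ∷ v) (br b ∷ w) (clean-br a∉P cl) eq fr with ∷-injective eq
... | refl , eq' = ⊑ᵇ-refl ∷ clean⇒⊑ v w cl eq' free-tail
  where
    free-tail : ∀ c → Free c w → c ∈ a ∷ _
    free-tail c f with c ≟ a
    ... | yes c≡a = here c≡a
    ... | no  c≢a = there (fr c (free-br c≢a f))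

-- The exchange property behind the transitivity of `_⊑α_`: bars added after an α-conversion can be
-- added before it instead.
Simulates : List Bar → List Bar → Set
Simulates v w = ∀ {w'} → w ⊑ w' → ∃[ v' ] (v ⊑ v' × v' ≡α w')

-- The side condition of α-step depends on ub only, which ⊑ preserves.
abs-simulates : ∀ p {a v b u} → AbsEq actBS a v b u → Simulates (p ++ br a ∷ v) (p ++ br b ∷ u)
abs-simulates (l ∷ p) e (l⊑l' ∷ w⊑w') with abs-simulates p e w⊑w'
... | v' , v⊑v' , v'≡w' = _ ∷ v' , l⊑l' ∷ v⊑v' , α-cong _ v'≡w'
abs-simulates [] {a} {v} {b} {u} (c , c≢a , c≢b , c#v , c#u , eq) (_∷_ {ys = u'} ⊑ᵇ-refl u⊑u') =
  br a ∷ v' , ⊑ᵇ-refl ∷ v⊑v' ,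
  α-step [] a v' b u'
    (c , c≢a , c≢b
    , ∉ub⇒fresh (≡.subst (c ∉_) (⊑-ub v⊑v') (fresh⇒∉ub c#v))
    , ∉ub⇒fresh (≡.subst (c ∉_) (⊑-ub u⊑u') (fresh⇒∉ub c#u))
    , actBS-swap-invol c a (actBS (swapP c b) u'))
  where
    v' = actBS (swapP c a) (actBS (swapP c b) u')
    v⊑v' : v ⊑ v'
    v⊑v' = ≡.subst (_⊑ v') (trans (cong (actBS (swapP c a)) (sym eq)) (actBS-swap-invol c a v))
             (⊑-act (swapP c a) (⊑-act (swapP c b) u⊑u'))

simulates-trans : ∀ {u v w} → Simulates u v → Simulates v w → Simulates u w
simulates-trans s t w⊑w' with t w⊑w'
... | v' , v⊑v' , v'≡w' with s v⊑v'
...   | u' , u⊑u' , u'≡v' = u' , u⊑u' , α-trans u'≡v' v'≡w'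

α-simulates : ∀ {v w} → v ≡α w → Simulates v w × Simulates w v
α-simulates (α-refl v)    = (λ p → _ , p , α-refl _) , (λ p → _ , p , α-refl _)
α-simulates (α-sym p)     = proj₂ (α-simulates p) , proj₁ (α-simulates p)
α-simulates (α-trans p q) =
  simulates-trans (proj₁ (α-simulates p)) (proj₁ (α-simulates q)) ,
  simulates-trans (proj₂ (α-simulates q)) (proj₂ (α-simulates p))
α-simulates (α-step w a v b u e) = abs-simulates w e , abs-simulates w (AbsEq-sym e)

_⊑α_ : List Bar → List Bar → Set
v ⊑α w = ∃[ v' ] (v ⊑ v' × v' ≡α w)

⊑⇒⊑α : ∀ {v w} → v ⊑ w → v ⊑α w
⊑⇒⊑α p = _ , p , α-refl _

α⇒⊑α : ∀ {v w} → v ≡α w → v ⊑α w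
α⇒⊑α e = _ , ⊑-refl , e

⊑α-refl : ∀ {v} → v ⊑α v
⊑α-refl = ⊑⇒⊑α ⊑-refl

⊑α-trans : ∀ {u v w} → u ⊑α v → v ⊑α w → u ⊑α w
⊑α-trans (_ , u⊑u' , u'≡v) (_ , v⊑v' , v'≡w) with proj₁ (α-simulates u'≡v) v⊑v'
... | _ , u'⊑u″ , u″≡v' = _ , ⊑-trans u⊑u' u'⊑u″ , α-trans u″≡v' v'≡w

⊑α-cong : ∀ l {v w} → v ⊑α w → (l ∷ v) ⊑α (l ∷ w)
⊑α-cong l (v' , v⊑v' , v'≡w) = l ∷ v' , ⊑ᵇ-refl ∷ v⊑v' , α-cong l v'≡w

-- The words of a term

data _⊩_ : ∀ {n} → Term ⊤ n → List Bar → Set where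
  ⊩-var : ∀ {x} → var x ⊩ []
  ⊩-inl : ∀ {n} {t u : Term ⊤ n} {v} → t ⊩ v → plus t u ⊩ v
  ⊩-inr : ∀ {n} {t u : Term ⊤ n} {v} → u ⊩ v → plus t u ⊩ v
  ⊩-pre : ∀ {n} {t : Term ⊤ n} {a v} → t ⊩ v → pre a t ⊩ (nm a ∷ v)
  ⊩-abs : ∀ {n} {t : Term ⊤ n} {a v} → t ⊩ v → abs a t ⊩ (br a ∷ v)

actT₁ : Perm → ∀ {n} → Term ⊤ n → Term ⊤ n
actT₁ = actT (act OneN)

names : ∀ {n} → Term ⊤ n → List Name
names (var _)    = []
names zer        = []
names (plus t u) = names t ++ names u
names (pre a t)  = a ∷ names t
names (abs a t)  = a ∷ names t

⊩-names : ∀ {n} {t : Term ⊤ n} {v c} → t ⊩ v → c ∈ ub v → c ∈ names t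
⊩-names (⊩-inl m)           c∈         = ∈-++⁺ˡ (⊩-names m c∈)
⊩-names (⊩-inr {t = t} m)   c∈         = ∈-++⁺ʳ (names t) (⊩-names m c∈)
⊩-names (⊩-pre m)           (here c≡a) = here c≡a
⊩-names (⊩-pre m)           (there c∈) = there (⊩-names m c∈)
⊩-names (⊩-abs m)           (here c≡a) = here c≡a
⊩-names (⊩-abs m)           (there c∈) = there (⊩-names m c∈)

⊩-length : ∀ {n} {t : Term ⊤ n} {v} → t ⊩ v → length v ≡ n
⊩-length ⊩-var     = refl
⊩-length (⊩-inl m) = ⊩-length m
⊩-length (⊩-inr m) = ⊩-length m
⊩-length (⊩-pre m) = cong suc (⊩-length m)
⊩-length (⊩-abs m) = cong suc (⊩-length m)

⊩-act : ∀ π {n} {t : Term ⊤ n} {v} → t ⊩ v → actT₁ π t ⊩ actBS π v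
⊩-act π ⊩-var     = ⊩-var
⊩-act π (⊩-inl m) = ⊩-inl (⊩-act π m)
⊩-act π (⊩-inr m) = ⊩-inr (⊩-act π m)
⊩-act π (⊩-pre m) = ⊩-pre (⊩-act π m)
⊩-act π (⊩-abs m) = ⊩-abs (⊩-act π m)

⊩-act⁻ : ∀ π {n} (t : Term ⊤ n) {v} → actT₁ π t ⊩ v → ∃[ v' ] (t ⊩ v' × v ≡ actBS π v')
⊩-act⁻ π (var x)    ⊩-var = [] , ⊩-var , refl
⊩-act⁻ π (plus t u) (⊩-inl m) with ⊩-act⁻ π t m
... | v' , m' , eq = v' , ⊩-inl m' , eq
⊩-act⁻ π (plus t u) (⊩-inr m) with ⊩-act⁻ π u m
... | v' , m' , eq = v' , ⊩-inr m' , eq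
⊩-act⁻ π (pre a t)  (⊩-pre m) with ⊩-act⁻ π t m
... | v' , m' , eq = nm a ∷ v' , ⊩-pre m' , cong (_ ∷_) eq
⊩-act⁻ π (abs a t)  (⊩-abs m) with ⊩-act⁻ π t m
... | v' , m' , eq = br a ∷ v' , ⊩-abs m' , cong (_ ∷_) eq

-- The swapping argument of `fresh⇒∉ub`, applied to the finite list of names written in `t`.
fresh⇒∉words : ∀ {n c} {t : Term ⊤ n} {v} → Fresh (λ π → actT₁ π {n}) c t → t ⊩ v → c ∉ ub v
fresh⇒∉words {n} {c} {t} {v} (s , supp , c∉s) m c∈ =
  d∉t (≡.subst (_∈ names t) (swapN-left c d) (⊩-names swapped (∈-ub-act (swapP c d) v c∈)))
  where
    d = fresh (s ++ names t)
    d∉s = ∉-++ˡ {xs = s} (fresh-∉ (s ++ names t))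
    d∉t = ∉-++ʳ s (fresh-∉ (s ++ names t))
    swapped : t ⊩ actBS (swapP c d) v
    swapped = ≡.subst (_⊩ actBS (swapP c d) v) (supp (swapP c d) (swapN-fixes s c∉s d∉s))
                      (⊩-act (swapP c d) m)

-- Soundness of derivability for the lower (Hoare) preorder on sets of words.

_≲_ : ∀ {n} → Term ⊤ n → Term ⊤ n → Set
t ≲ u = ∀ {v} → t ⊩ v → ∃[ w ] (u ⊩ w × v ⊑α w)

≲-trans : ∀ {n} {t u r : Term ⊤ n} → t ≲ u → u ≲ r → t ≲ r
≲-trans t≲u u≲r m with t≲u m
... | _ , m' , p with u≲r m'
...   | _ , m″ , q = _ , m″ , ⊑α-trans p q

≲-words : ∀ {n} {t u : Term ⊤ n} → (∀ {v} → t ⊩ v → u ⊩ v) → t ≲ u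
≲-words f m = _ , f m , ⊑α-refl

plus-mono-≲ : ∀ {n} {t t' u u' : Term ⊤ n} → t ≲ t' → u ≲ u' → plus t u ≲ plus t' u'
plus-mono-≲ p q (⊩-inl m) with p m
... | _ , m' , r = _ , ⊩-inl m' , r
plus-mono-≲ p q (⊩-inr m) with q m
... | _ , m' , r = _ , ⊩-inr m' , r

pre-mono-≲ : ∀ {n} a {t t' : Term ⊤ n} → t ≲ t' → pre a t ≲ pre a t'
pre-mono-≲ a p (⊩-pre m) with p m
... | _ , m' , r = _ , ⊩-pre m' , ⊑α-cong _ r

abs-mono-≲ : ∀ {n} a {t t' : Term ⊤ n} → t ≲ t' → abs a t ≲ abs a t'
abs-mono-≲ a p (⊩-abs m) with p m
... | _ , m' , r = _ , ⊩-abs m' , ⊑α-cong _ r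

-- The two sides of each axiom have literally the same words, except for `ax-preabs`, where `nm⊑br`
-- absorbs the additional ones.
Ax-sound : ∀ {Y m l r s} → Ax Y m r s → (τ : Perm) (σ : Car (nom Y) → Term ⊤ l) →
           let r' = subst σ (actT (act (nom Y)) τ r) ; s' = subst σ (actT (act (nom Y)) τ s)
           in (r' ≲ s') × (s' ≲ r')
Ax-sound (ax-unit x) τ σ = ≲-words (λ { (⊩-inl m) → m }) , ≲-words ⊩-inl
Ax-sound (ax-idem x) τ σ = ≲-words (λ { (⊩-inl m) → m ; (⊩-inr m) → m }) , ≲-words ⊩-inl
Ax-sound (ax-comm x y) τ σ = ≲-words (λ { (⊩-inl m) → ⊩-inr m ; (⊩-inr m) → ⊩-inl m })
                           , ≲-words (λ { (⊩-inl m) → ⊩-inr m ; (⊩-inr m) → ⊩-inl m })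
Ax-sound (ax-assoc x y z) τ σ =
    ≲-words (λ { (⊩-inl (⊩-inl m)) → ⊩-inl m ; (⊩-inl (⊩-inr m)) → ⊩-inr (⊩-inl m) ; (⊩-inr m) → ⊩-inr (⊩-inr m) })
  , ≲-words (λ { (⊩-inl m) → ⊩-inl (⊩-inl m) ; (⊩-inr (⊩-inl m)) → ⊩-inl (⊩-inr m) ; (⊩-inr (⊩-inr m)) → ⊩-inr m })
Ax-sound (ax-pre+ a x y) τ σ =
    ≲-words (λ { (⊩-pre (⊩-inl m)) → ⊩-inl (⊩-pre m) ; (⊩-pre (⊩-inr m)) → ⊩-inr (⊩-pre m) })
  , ≲-words (λ { (⊩-inl (⊩-pre m)) → ⊩-pre (⊩-inl m) ; (⊩-inr (⊩-pre m)) → ⊩-pre (⊩-inr m) })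
Ax-sound (ax-pre0 a) τ σ = ≲-words (λ { (⊩-pre ()) }) , ≲-words (λ ())
Ax-sound (ax-abs+ a x y) τ σ =
    ≲-words (λ { (⊩-abs (⊩-inl m)) → ⊩-inl (⊩-abs m) ; (⊩-abs (⊩-inr m)) → ⊩-inr (⊩-abs m) })
  , ≲-words (λ { (⊩-inl (⊩-abs m)) → ⊩-abs (⊩-inl m) ; (⊩-inr (⊩-abs m)) → ⊩-abs (⊩-inr m) })
Ax-sound (ax-abs0 a) τ σ = ≲-words (λ { (⊩-abs ()) }) , ≲-words (λ ())
Ax-sound (ax-preabs a x) τ σ =
    (λ { (⊩-inl (⊩-pre m)) → _ , ⊩-abs m , ⊑⇒⊑α (nm⊑br ∷ ⊑-refl) ; (⊩-inr m) → _ , m , ⊑α-refl })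
  , ≲-words ⊩-inr

Der-sound : ∀ {n} {t u : Term ⊤ n} → Der OneN n t u → (t ≲ u) × (u ≲ t)
Der-sound (d-refl x)    = ≲-words id , ≲-words id
Der-sound (d-symm d)    = proj₂ (Der-sound d) , proj₁ (Der-sound d)
Der-sound (d-trans d e) = ≲-trans (proj₁ (Der-sound d)) (proj₁ (Der-sound e))
                        , ≲-trans (proj₂ (Der-sound e)) (proj₂ (Der-sound d))
Der-sound d-cong0       = ≲-words id , ≲-words id
Der-sound (d-cong+ d e) = plus-mono-≲ (proj₁ (Der-sound d)) (proj₁ (Der-sound e))
                        , plus-mono-≲ (proj₂ (Der-sound d)) (proj₂ (Der-sound e))
Der-sound (d-congpre a d) = pre-mono-≲ a (proj₁ (Der-sound d)) , pre-mono-≲ a (proj₂ (Der-sound d))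
Der-sound (d-congabs a d) = abs-mono-≲ a (proj₁ (Der-sound d)) , abs-mono-≲ a (proj₂ (Der-sound d))
Der-sound (d-ax Y ax τ σ _) = Ax-sound ax τ σ
Der-sound {suc n} (d-perm {t = t} {u = u} a b d a≢b a#u) =
    ≲-trans (abs-mono-≲ a (proj₁ (Der-sound d))) back , ≲-trans forth (abs-mono-≲ a (proj₂ (Der-sound d)))
  where
    -- Freshness of `a` for the whole term `u` excludes it from every single word, so the words can
    -- be renamed one by one.
    rename : ∀ {w} → u ⊩ w → (br b ∷ w) ≡α (br a ∷ actBS (swapP a b) w)
    rename {w} m = α-rename a b w (fresh⇒∉words a#u m)
    forth : abs b u ≲ abs a (actT₁ (swapP a b) u)
    forth (⊩-abs m) = _ , ⊩-abs (⊩-act (swapP a b) m) , α⇒⊑α (rename m)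
    back : abs a (actT₁ (swapP a b) u) ≲ abs b u
    back (⊩-abs m) with ⊩-act⁻ (swapP a b) u m
    ... | w , m' , refl = _ , ⊩-abs m' , α⇒⊑α (α-sym (rename m'))

-- Derivability for arbitrary terms

der-refl : ∀ {n} (t : Term ⊤ n) → Der OneN n t t
der-refl (var x)    = d-refl x
der-refl zer        = d-cong0
der-refl (plus t u) = d-cong+ (der-refl t) (der-refl u)
der-refl (pre a t)  = d-congpre a (der-refl t)
der-refl (abs a t)  = d-congabs a (der-refl t)

der-≡ : ∀ {n} {t u : Term ⊤ n} → t ≡ u → Der OneN n t u
der-≡ {t = t} refl = der-refl t

-- Tuples of names as orbit-finite sets of variables.

actV : ∀ {k} → Perm → Vec Name k → Vec Name k
actV π = Vec.map (to π)

actV-supported : ∀ {k} (xs : Vec Name k) → Supports actV (toList xs) xs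
actV-supported []       π fix = refl
actV-supported (x ∷ xs) π fix =
  cong₂ _∷_ (fix x (here refl)) (actV-supported xs π (λ a → fix a ∘ there))

-- The orbit of a tuple records only which entries coincide, so a new entry either repeats an old
-- one or is new, and a single fresh name represents the second case.
extensions : ∀ {k} → Vec Name k → List (Vec Name (suc k))
extensions o = map (_∷ o) (fresh (toList o) ∷ toList o)

orbitsV : ∀ k → List (Vec Name k)
orbitsV zero    = [] ∷ []
orbitsV (suc k) = concatMap extensions (orbitsV k)

orbitsV-complete : ∀ {k} (xs : Vec Name k) → ∃[ o ] (o ∈ orbitsV k × ∃[ π ] (actV π o ≡ xs))
orbitsV-complete []       = [] , here refl , idP , refl
orbitsV-complete (b ∷ xs) with orbitsV-complete xs
... | o , o∈ , π , refl with from π b ∈? toList o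
...   | yes a∈ = from π b ∷ o
               , ∈-concatMap⁺ extensions (lose o∈ (∈-map⁺ (_∷ o) (there a∈)))
               , π , cong (_∷ actV π o) (to-from π b)
...   | no a∉  = c ∷ o
               , ∈-concatMap⁺ extensions (lose o∈ (here refl))
               -- The swap turns the representative `c` into `a`, which `π` sends to `b`. It fixes
               -- `o`, which contains neither name.
               , π ∘P swapP c a
               , cong₂ _∷_ (trans (cong (to π) (swapN-left c a)) (to-from π b))
                   (trans (Vecₚ.map-∘ (to π) (swapN c a) o)
                     (cong (actV π) (actV-supported o (swapP c a)
                        (swapN-fixes (toList o) (fresh-∉ (toList o)) a∉))))
  where
    a = from π b
    c = fresh (toList o)

-- No axiom has more than three variables.
Vars : ℕ → OFNomSet
Vars k = record
  { nom = record
    { Car     = Fin 3 × Vec Name k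
    ; act     = λ { π (i , xs) → i , actV π xs }
    ; act-id  = λ { (i , xs) → cong (i ,_) (Vecₚ.map-id xs) }
    ; act-∘   = λ { π ρ (i , xs) → cong (i ,_) (Vecₚ.map-∘ (to π) (to ρ) xs) }
    ; act-ext = λ { π ρ eq (i , xs) → cong (i ,_) (Vecₚ.map-cong eq xs) }
    ; finSupp = λ { (i , xs) → toList xs , λ π fix → cong (i ,_) (actV-supported xs π fix) }
    }
  ; orbFin = cartesianProduct (allFin 3) (orbitsV k) , complete
  }
  where
    complete : ∀ (x : Fin 3 × Vec Name k) → ∃[ o ] (o ∈ cartesianProduct (allFin 3) (orbitsV k) ×
                                           ∃[ π ] ((proj₁ o , actV π (proj₂ o)) ≡ x))
    complete (i , xs) with orbitsV-complete xs
    ... | o , o∈ , π , eq = (i , o) , ∈-cartesianProduct⁺ (∈-allFin i) o∈ , π , cong (i ,_) eq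

-- Out of range indices are sent to the last entry, which makes clamp
-- equivariant without side condition.
clamp : ∀ {k} → Vec Name (suc k) → Name → Name
clamp (x ∷ [])         _       = x
clamp (x ∷ xs@(_ ∷ _)) zero    = x
clamp (x ∷ xs@(_ ∷ _)) (suc a) = clamp xs a

clamp-act : ∀ π {k} (xs : Vec Name (suc k)) a → clamp (actV π xs) a ≡ to π (clamp xs a)
clamp-act π (x ∷ [])         a       = refl
clamp-act π (x ∷ xs@(_ ∷ _)) zero    = refl
clamp-act π (x ∷ xs@(_ ∷ _)) (suc a) = clamp-act π xs a

range : Name → ∀ k → Vec Name k
range b zero    = []
range b (suc k) = b ∷ range (suc b) k

clamp-range : ∀ b k a → a ≤ k → clamp (range b (suc k)) a ≡ b + a
clamp-range b zero    zero    a≤k       = sym (+-identityʳ b)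
clamp-range b (suc k) zero    a≤k       = sym (+-identityʳ b)
clamp-range b (suc k) (suc a) (s≤s a≤k) = trans (clamp-range (suc b) k a a≤k) (sym (+-suc b a))

-- An arbitrary function is allowed because `clamp xs` need not be injective. Capture is harmless:
-- only raw equality of terms is needed below.
renameT : (Name → Name) → ∀ {n} → Term ⊤ n → Term ⊤ n
renameT f (var x)    = var x
renameT f zer        = zer
renameT f (plus t u) = plus (renameT f t) (renameT f u)
renameT f (pre a t)  = pre (f a) (renameT f t)
renameT f (abs a t)  = abs (f a) (renameT f t)

renameT-id : ∀ f {n} (t : Term ⊤ n) → (∀ a → a ∈ names t → f a ≡ a) → renameT f t ≡ t
renameT-id f (var x)    fix = refl
renameT-id f zer        fix = refl
renameT-id f (plus t u) fix = cong₂ plus (renameT-id f t (λ a → fix a ∘ ∈-++⁺ˡ))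
                                         (renameT-id f u (λ a → fix a ∘ ∈-++⁺ʳ (names t)))
renameT-id f (pre a t)  fix = cong₂ pre (fix a (here refl)) (renameT-id f t (λ b → fix b ∘ there))
renameT-id f (abs a t)  fix = cong₂ abs (fix a (here refl)) (renameT-id f t (λ b → fix b ∘ there))

renameT-act : ∀ π f g {n} (t : Term ⊤ n) → (∀ a → g a ≡ to π (f a)) →
              actT₁ π (renameT f t) ≡ renameT g t
renameT-act π f g (var x)    eq = refl
renameT-act π f g zer        eq = refl
renameT-act π f g (plus t u) eq = cong₂ plus (renameT-act π f g t eq) (renameT-act π f g u eq)
renameT-act π f g (pre a t)  eq = cong₂ pre (sym (eq a)) (renameT-act π f g t eq)
renameT-act π f g (abs a t)  eq = cong₂ abs (sym (eq a)) (renameT-act π f g t eq)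

-- `d-ax` demands an equivariant substitution on an orbit-finite set, which rules out sending bare
-- variables to arbitrary terms. Here a variable carries a tuple, and `σ` reads each name of `ts i`
-- as a position in it. Permuting the tuple then permutes the term, and the tuple `0, ..., bound`
-- gives back `ts i`.
module Instance {l} (ts : Fin 3 → Term ⊤ l) where
  bound : ℕ
  bound = sum (names (ts 0F) ++ names (ts 1F) ++ names (ts 2F))

  Y : OFNomSet
  Y = Vars (suc bound)

  σ : Car (nom Y) → Term ⊤ l
  σ (i , xs) = renameT (clamp xs) (ts i)

  x : Fin 3 → Car (nom Y)
  x i = i , range 0 (suc bound)

  σ-equivariant : ∀ π y → Der OneN l (actT₁ π (σ y)) (σ (act (nom Y) π y))
  σ-equivariant π (i , xs) = der-≡ (renameT-act π (clamp xs) _ (ts i) (clamp-act π xs))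

  names-bounded : ∀ i {a} → a ∈ names (ts i) → a ≤ bound
  names-bounded 0F a∈ = ∈⇒≤sum _ (∈-++⁺ˡ a∈)
  names-bounded 1F a∈ = ∈⇒≤sum _ (∈-++⁺ʳ (names (ts 0F)) (∈-++⁺ˡ a∈))
  names-bounded 2F a∈ = ∈⇒≤sum _ (∈-++⁺ʳ (names (ts 0F)) (∈-++⁺ʳ (names (ts 1F)) a∈))

  σx : ∀ i → σ (act (nom Y) idP (x i)) ≡ ts i
  σx i = trans (cong σ (act-id (nom Y) (x i)))
               (renameT-id _ (ts i) (λ a a∈ → clamp-range 0 bound a (names-bounded i a∈)))

  instantiate : ∀ {m r s} → Ax Y m r s →
                Der OneN (m + l) (subst σ (actT (act (nom Y)) idP r)) (subst σ (actT (act (nom Y)) idP s))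
  instantiate ax = d-ax Y ax idP σ σ-equivariant

triple : ∀ {A : Set} → A → A → A → Fin 3 → A
triple t u r 0F = t
triple t u r 1F = u
triple t u r 2F = r

plus-identityʳ : ∀ {n} (t : Term ⊤ n) → Der OneN n (plus t zer) t
plus-identityʳ t = ≡.subst₂ (Der OneN _) (cong₂ plus (σx 0F) refl) (σx 0F) (instantiate (ax-unit (x 0F)))
  where open Instance (triple t t t)

plus-idem : ∀ {n} (t : Term ⊤ n) → Der OneN n (plus t t) t
plus-idem t = ≡.subst₂ (Der OneN _) (cong₂ plus (σx 0F) (σx 0F)) (σx 0F) (instantiate (ax-idem (x 0F)))
  where open Instance (triple t t t)

plus-comm : ∀ {n} (t u : Term ⊤ n) → Der OneN n (plus t u) (plus u t)
plus-comm t u =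
  ≡.subst₂ (Der OneN _) (cong₂ plus (σx 0F) (σx 1F)) (cong₂ plus (σx 1F) (σx 0F))
    (instantiate (ax-comm (x 0F) (x 1F)))
  where open Instance (triple t u u)

plus-assoc : ∀ {n} (t u r : Term ⊤ n) → Der OneN n (plus (plus t u) r) (plus t (plus u r))
plus-assoc t u r =
  ≡.subst₂ (Der OneN _) (cong₂ plus (cong₂ plus (σx 0F) (σx 1F)) (σx 2F))
    (cong₂ plus (σx 0F) (cong₂ plus (σx 1F) (σx 2F)))
    (instantiate (ax-assoc (x 0F) (x 1F) (x 2F)))
  where open Instance (triple t u r)

pre-plus : ∀ {n} a (t u : Term ⊤ n) → Der OneN (suc n) (pre a (plus t u)) (plus (pre a t) (pre a u))
pre-plus a t u =
  ≡.subst₂ (Der OneN _) (cong (pre a) (cong₂ plus (σx 0F) (σx 1F)))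
    (cong₂ plus (cong (pre a) (σx 0F)) (cong (pre a) (σx 1F)))
    (instantiate (ax-pre+ a (x 0F) (x 1F)))
  where open Instance (triple t u u)

abs-plus : ∀ {n} a (t u : Term ⊤ n) → Der OneN (suc n) (abs a (plus t u)) (plus (abs a t) (abs a u))
abs-plus a t u =
  ≡.subst₂ (Der OneN _) (cong (abs a) (cong₂ plus (σx 0F) (σx 1F)))
    (cong₂ plus (cong (abs a) (σx 0F)) (cong (abs a) (σx 1F)))
    (instantiate (ax-abs+ a (x 0F) (x 1F)))
  where open Instance (triple t u u)

pre-abs : ∀ {n} a (t : Term ⊤ n) → Der OneN (suc n) (plus (pre a t) (abs a t)) (abs a t)
pre-abs a t =
  ≡.subst₂ (Der OneN _) (cong₂ plus (cong (pre a) (σx 0F)) (cong (abs a) (σx 0F))) (cong (abs a) (σx 0F))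
    (instantiate (ax-preabs a (x 0F)))
  where open Instance (triple t t t)

pre-zer : ∀ {n} a → Der OneN (suc n) (pre a zer) zer
pre-zer a = d-ax EmptyOF (ax-pre0 a) idP (λ ()) (λ _ ())

abs-zer : ∀ {n} a → Der OneN (suc n) (abs a zer) zer
abs-zer a = d-ax EmptyOF (ax-abs0 a) idP (λ ()) (λ _ ())

-- The order on terms induced by plus

_≼_ : ∀ {n} → Term ⊤ n → Term ⊤ n → Set₁
_≼_ {n} t u = Der OneN n (plus t u) u

der⇒≼ : ∀ {n} {t u : Term ⊤ n} → Der OneN n t u → t ≼ u
der⇒≼ {u = u} d = d-trans (d-cong+ d (der-refl u)) (plus-idem u)

≼-trans : ∀ {n} {t u r : Term ⊤ n} → t ≼ u → u ≼ r → t ≼ r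
≼-trans {t = t} {u} {r} t≼u u≼r =
  d-trans (d-cong+ (der-refl t) (d-symm u≼r))
    (d-trans (d-symm (plus-assoc t u r)) (d-trans (d-cong+ t≼u (der-refl r)) u≼r))

≼-antisym : ∀ {n} {t u : Term ⊤ n} → t ≼ u → u ≼ t → Der OneN n t u
≼-antisym {t = t} {u} t≼u u≼t = d-trans (d-symm u≼t) (d-trans (plus-comm u t) t≼u)

zer-≼ : ∀ {n} (u : Term ⊤ n) → zer ≼ u
zer-≼ u = d-trans (plus-comm zer u) (plus-identityʳ u)

plus-lub : ∀ {n} {t u r : Term ⊤ n} → t ≼ r → u ≼ r → plus t u ≼ r
plus-lub {t = t} {u} {r} t≼r u≼r =
  d-trans (plus-assoc t u r) (d-trans (d-cong+ (der-refl t) u≼r) t≼r)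

≼-plusˡ : ∀ {n} (t u : Term ⊤ n) → t ≼ plus t u
≼-plusˡ t u = d-trans (d-symm (plus-assoc t t u)) (d-cong+ (plus-idem t) (der-refl u))

≼-plusʳ : ∀ {n} (t u : Term ⊤ n) → u ≼ plus t u
≼-plusʳ t u = ≼-trans (≼-plusˡ u t) (der⇒≼ (plus-comm u t))

-- Linear contexts and the decomposition of a term into words.

record Linear {m n} (C : Term ⊤ m → Term ⊤ n) : Set₁ where
  field
    resp  : ∀ {t u} → Der OneN m t u → Der OneN n (C t) (C u)
    plus↦ : ∀ t u → Der OneN n (C (plus t u)) (plus (C t) (C u))
    zer↦  : Der OneN n (C zer) zer

  mono : ∀ {t u} → t ≼ u → C t ≼ C u
  mono {t} {u} t≼u = d-trans (d-symm (plus↦ t u)) (resp t≼u)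
open Linear

id-linear : ∀ {n} → Linear {n} id
id-linear = record { resp = id ; plus↦ = λ t u → der-refl (plus t u) ; zer↦ = d-cong0 }

pre-linear : ∀ {n} a → Linear {n} (pre a)
pre-linear a = record { resp = d-congpre a ; plus↦ = pre-plus a ; zer↦ = pre-zer a }

abs-linear : ∀ {n} a → Linear {n} (abs a)
abs-linear a = record { resp = d-congabs a ; plus↦ = abs-plus a ; zer↦ = abs-zer a }

∘-linear : ∀ {k m n} {C : Term ⊤ m → Term ⊤ n} {D : Term ⊤ k → Term ⊤ m} →
           Linear C → Linear D → Linear (C ∘ D)
∘-linear L M = record
  { resp  = resp L ∘ resp M
  ; plus↦ = λ t u → d-trans (resp L (plus↦ M t u)) (plus↦ L _ _)
  ; zer↦  = d-trans (resp L (zer↦ M)) (zer↦ L)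
  }

-- Bar strings whose length is not n are sent to the junk value zer.
word : ∀ n → List Bar → Term ⊤ n
word zero    []         = var tt
word zero    (_ ∷ _)    = zer
word (suc n) []         = zer
word (suc n) (nm a ∷ v) = pre a (word n v)
word (suc n) (br a ∷ v) = abs a (word n v)

word-act : ∀ π n v → actT₁ π (word n v) ≡ word n (actBS π v)
word-act π zero    []         = refl
word-act π zero    (_ ∷ _)    = refl
word-act π (suc n) []         = refl
word-act π (suc n) (nm a ∷ v) = cong (pre (to π a)) (word-act π n v)
word-act π (suc n) (br a ∷ v) = cong (abs (to π a)) (word-act π n v)

word-supported : ∀ n {s v} → Supports actBS s v → Supports (λ π → actT₁ π {n}) s (word n v)
word-supported n {v = v} supp π fix = trans (word-act π n v) (cong (word n) (supp π fix))

-- `C` collects the prefixes already passed, and its linearity splits sums beneath them. With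
-- `word-≼`, this makes `t` the join of its words.
words-≼ : ∀ {m n} (t : Term ⊤ m) {C : Term ⊤ m → Term ⊤ n} {u} → Linear C →
          (∀ {v} → t ⊩ v → C (word m v) ≼ u) → C t ≼ u
words-≼ (var x) L f = f ⊩-var
words-≼ zer {u = u} L f = ≼-trans (der⇒≼ (zer↦ L)) (zer-≼ u)
words-≼ (plus t t') L f =
  ≼-trans (der⇒≼ (plus↦ L t t')) (plus-lub (words-≼ t L (f ∘ ⊩-inl)) (words-≼ t' L (f ∘ ⊩-inr)))
words-≼ (pre a t) L f = words-≼ t (∘-linear L (pre-linear a)) (f ∘ ⊩-pre)
words-≼ (abs a t) L f = words-≼ t (∘-linear L (abs-linear a)) (f ∘ ⊩-abs)

word-≼ : ∀ {n} {t : Term ⊤ n} {v} → t ⊩ v → word n v ≼ t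
word-≼ ⊩-var = der⇒≼ (d-refl tt)
word-≼ (⊩-inl m) = ≼-trans (word-≼ m) (≼-plusˡ _ _)
word-≼ (⊩-inr m) = ≼-trans (word-≼ m) (≼-plusʳ _ _)
word-≼ (⊩-pre m) = mono (pre-linear _) (word-≼ m)
word-≼ (⊩-abs m) = mono (abs-linear _) (word-≼ m)

word-⊑ : ∀ n {v w} → v ⊑ w → word n v ≼ word n w
word-⊑ zero    []       = der⇒≼ (d-refl tt)
word-⊑ zero    (_ ∷ _)  = zer-≼ zer
word-⊑ (suc n) []       = zer-≼ zer
word-⊑ (suc n) (_∷_ {nm a} ⊑ᵇ-refl p) = mono (pre-linear a) (word-⊑ n p)
word-⊑ (suc n) (_∷_ {br a} ⊑ᵇ-refl p) = mono (abs-linear a) (word-⊑ n p)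
-- By the definition of `_≼_`, the axiom `pre-abs` is itself the inequality between the two
-- prefixes.
word-⊑ (suc n) (nm⊑br {a} ∷ p) = ≼-trans (pre-abs a _) (mono (abs-linear a) (word-⊑ n p))

-- Both sides equal abs c (word n (actBS (swapP c a) v)) by d-perm.
word-abs : ∀ n {a v b u} → AbsEq actBS a v b u →
           Der OneN (suc n) (abs a (word n v)) (abs b (word n u))
word-abs n {a} {v} {b} {u} (c , c≢a , c≢b , (s , sv , c∉s) , (s' , su , c∉s') , eq) =
  d-trans (d-symm (d-perm c a (der-refl _) c≢a (s , word-supported n sv , c∉s)))
          (d-perm c b (der-≡ swapped) c≢b (s' , word-supported n su , c∉s'))
  where
    swapped : actT₁ (swapP c a) (word n v) ≡ actT₁ (swapP c b) (word n u)
    swapped = trans (word-act (swapP c a) n v)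
                (trans (cong (word n) eq) (sym (word-act (swapP c b) n u)))

word-step : ∀ n w {a v b u} → AbsEq actBS a v b u →
            Der OneN n (word n (w ++ br a ∷ v)) (word n (w ++ br b ∷ u))
word-step zero    []         e = d-cong0
word-step zero    (_ ∷ _)    e = d-cong0
word-step (suc n) []         e = word-abs n e
word-step (suc n) (nm a ∷ w) e = d-congpre a (word-step n w e)
word-step (suc n) (br a ∷ w) e = d-congabs a (word-step n w e)

word-α : ∀ n {v w} → v ≡α w → Der OneN n (word n v) (word n w)
word-α n (α-refl v)           = der-refl (word n v)
word-α n (α-sym p)            = d-symm (word-α n p)
word-α n (α-trans p q)        = d-trans (word-α n p) (word-α n q)
word-α n (α-step w a v b u e) = word-step n w e

-- Completeness, complementing `Der-sound`: each word of `t` is raised by adding bars, α-converted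
-- into a word of `u`, and so lies below `u`.
≲⇒≼ : ∀ {n} (t u : Term ⊤ n) → t ≲ u → t ≼ u
≲⇒≼ {n} t u t≲u = words-≼ t id-linear below
  where
    below : ∀ {v} → t ⊩ v → word n v ≼ u
    below m with t≲u m
    ... | _ , m' , (_ , p , e) = ≼-trans (word-⊑ n p) (≼-trans (der⇒≼ (word-α n e)) (word-≼ m'))

-- The words of the behaviour of a state

⊩-sumT⁺ : ∀ {A : Set} {m l} {σ : A → Term ⊤ l} {t : Term A m} {v} ts → t ∈ ts →
          subst σ t ⊩ v → subst σ (sumT ts) ⊩ v
⊩-sumT⁺ (t ∷ [])     (here refl) m = m
⊩-sumT⁺ (t ∷ _ ∷ _)  (here refl) m = ⊩-inl m
⊩-sumT⁺ (_ ∷ u ∷ ts) (there t∈)  m = ⊩-inr (⊩-sumT⁺ (u ∷ ts) t∈ m)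

⊩-sumT⁻ : ∀ {A : Set} {m l} {σ : A → Term ⊤ l} {v} (ts : List (Term A m)) →
          subst σ (sumT ts) ⊩ v → ∃[ t ] (t ∈ ts × subst σ t ⊩ v)
⊩-sumT⁻ (t ∷ [])     m         = t , here refl , m
⊩-sumT⁻ (t ∷ _ ∷ _)  (⊩-inl m) = t , here refl , m
⊩-sumT⁻ (_ ∷ u ∷ ts) (⊩-inr m) with ⊩-sumT⁻ (u ∷ ts) m
... | t , t∈ , m' = t , there t∈ , m'

module Behaviour (𝒬 : FBRNTS) where
  private
    Q = nom (St 𝒬)
    A = Car Q
    _·_ = act Q
    preOf absOf : Name × A → Term A 1
    preOf p = pre (proj₁ p) (var (proj₂ p))
    absOf p = abs (proj₁ p) (var (proj₂ p))

  -- Bound transitions enter only through the representatives listed in `γ`, not through all members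
  -- of the abstraction as in `Step`.
  data BehWord (q : A) (n : ℕ) : List Bar → Set where
    word-nm : ∀ {a q' v} → (a , q') ∈ proj₁ (γ 𝒬 q) → beh 𝒬 n q' ⊩ v → BehWord q n (nm a ∷ v)
    word-br : ∀ {a q' v} → (a , q') ∈ proj₂ (γ 𝒬 q) → beh 𝒬 n q' ⊩ v → BehWord q n (br a ∷ v)

  beh⁺ : ∀ {q n v} → BehWord q n v → beh 𝒬 (suc n) q ⊩ v
  beh⁺ (word-nm p∈ m) = ⊩-sumT⁺ _ (∈-++⁺ˡ (∈-map⁺ preOf p∈)) (⊩-pre m)
  beh⁺ {q} (word-br p∈ m) =
    ⊩-sumT⁺ _ (∈-++⁺ʳ (map preOf (proj₁ (γ 𝒬 q))) (∈-map⁺ absOf p∈)) (⊩-abs m)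

  beh⁻ : ∀ {q n v} → beh 𝒬 (suc n) q ⊩ v → BehWord q n v
  beh⁻ {q} m with ⊩-sumT⁻ _ m
  ... | t , t∈ , m' with ∈-++⁻ (map preOf (proj₁ (γ 𝒬 q))) t∈
  beh⁻ m | _ , _ , m' | inj₁ t∈ with ∈-map⁻ preOf t∈
  beh⁻ m | _ , _ , ⊩-pre m' | inj₁ _ | _ , p∈ , refl = word-nm p∈ m'
  beh⁻ m | _ , _ , m' | inj₂ t∈ with ∈-map⁻ absOf t∈
  beh⁻ m | _ , _ , ⊩-abs m' | inj₂ _ | _ , p∈ , refl = word-br p∈ m'

  -- Equivariance holds only up to `_≡α_`, since `γ-equiv` may change the listed representatives. It
  -- is stated per depth because the induction step uses its consequences at depth `n`.
  Equivariant : ℕ → Set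
  Equivariant n = ∀ π {q v} → beh 𝒬 n q ⊩ v → ∃[ w ] (beh 𝒬 n (π · q) ⊩ w × actBS π v ≡α w)

  -- If c were free in a word of q but fresh for q, swapping c with any d
  -- fresh for q would give a word of q with d free, yet q has finitely many
  -- words.
  words-fresh : ∀ {n} → Equivariant n → ∀ {q v c} → Fresh _·_ c q → beh 𝒬 n q ⊩ v → ¬ Free c v
  words-fresh {n} equiv {q} {v} {c} (s , supp , c∉s) m f =
    d∉beh (≡.subst (λ t → d ∈ names (beh 𝒬 n t)) cd·q≡q d∈)
    where
      avoid = s ++ names (beh 𝒬 n q)
      d = fresh avoid
      d∉s = ∉-++ˡ {xs = s} (fresh-∉ avoid)
      d∉beh = ∉-++ʳ s (fresh-∉ avoid)
      cd·q≡q : swapP c d · q ≡ q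
      cd·q≡q = supp (swapP c d) (swapN-fixes s c∉s d∉s)
      d∈ : d ∈ names (beh 𝒬 n (swapP c d · q))
      d∈ with equiv (swapP c d) m
      ... | w , m' , e =
        ⊩-names m' (free⇒∈ub (proj₁ (free-α e)
          (≡.subst (λ x → Free x (actBS (swapP c d) v)) (swapN-left c d) (free-act (swapP c d) f))))

  swap-invol : ∀ a b q → swapP a b · (swapP a b · q) ≡ q
  swap-invol a b q =
    trans (sym (act-∘ Q (swapP a b) (swapP a b) q))
          (trans (act-ext Q _ idP (swapN-invol a b) q) (act-id Q q))

  -- The word is carried from `q` to `q'` through their common renaming by `c`. By `words-fresh`,
  -- `c` is free in neither word, so both bars can be renamed to `c`.
  words-AbsEq : ∀ {n} → Equivariant n → ∀ {a q b q' v} → AbsEq _·_ a q b q' → beh 𝒬 n q ⊩ v →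
                ∃[ w ] (beh 𝒬 n q' ⊩ w × (br a ∷ v) ≡α (br b ∷ w))
  words-AbsEq {n} equiv {a} {q} {b} {q'} {v} (c , c≢a , c≢b , c#q , c#q' , eq) m
    with equiv (swapP c a) m
  ... | v₁ , m₁ , e₁ with equiv (swapP c b) m₁
  ...   | w , m₂ , e₂ =
    w , m' ,
    α-trans (α-rename-free c a v (words-fresh equiv c#q m))
      (α-trans (α-cong (br c) (α-trans e₁ (α-sym cb·w≡v₁)))
               (α-sym (α-rename-free c b w (words-fresh equiv c#q' m'))))
    where
      m' : beh 𝒬 n q' ⊩ w
      m' = ≡.subst (λ p → beh 𝒬 n p ⊩ w)
             (trans (cong (swapP c b ·_) eq) (swap-invol c b q')) m₂
      cb·w≡v₁ : actBS (swapP c b) w ≡α v₁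
      cb·w≡v₁ = ≡.subst (actBS (swapP c b) w ≡α_) (actBS-swap-invol c b v₁)
                  (α-act (swapP c b) (α-sym e₂))

  words-equivariant : ∀ n → Equivariant n
  words-equivariant zero    π ⊩-var = [] , ⊩-var , α-refl []
  words-equivariant (suc n) π {q} m with beh⁻ m
  ... | word-nm p∈ m₁ with words-equivariant n π m₁
  ...   | w , m₂ , e =
    nm _ ∷ w
    , beh⁺ (word-nm (Equivalence.from (proj₁ (γ-equiv 𝒬 π q) _) (∈-map⁺ _ p∈)) m₂)
    , α-cong _ e
  -- The permuted pair need not be listed at `π · q`. Some listed pair denotes the same abstraction,
  -- and `words-AbsEq` transfers the word to it.
  words-equivariant (suc n) π {q} m | word-br {a} {q'} p∈ m₁
    with words-equivariant n π m₁
       | Equivalence.from (proj₂ (γ-equiv 𝒬 π q) (to π a , π · q'))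
           (_ , ∈-map⁺ _ p∈ , AbsEq-refl Q (to π a) (π · q'))
  ... | w , m₂ , e | (b , q″) , p∈' , abs≡
    with words-AbsEq (words-equivariant n) (AbsEq-sym abs≡) m₂
  ...   | w' , m₃ , e' = br b ∷ w' , beh⁺ (word-br p∈' m₃) , α-trans (α-cong _ e) e'

  -- A path may choose any representative of a bound transition, so it is a word only up to
  -- α-equivalence. In `word⇒path` no such correction arises.
  path⇒word : ∀ {q p q'} → Path 𝒬 q p q' → ∃[ v ] (beh 𝒬 (length p) q ⊩ v × p ≡α v)
  path⇒word p-nil = [] , ⊩-var , α-refl []
  path⇒word (p-cons (step-nm p∈) path) with path⇒word path
  ... | v , m , e = nm _ ∷ v , beh⁺ (word-nm p∈ m) , α-cong _ e
  path⇒word (p-cons (step-br (_ , p∈ , abs≡)) path) with path⇒word path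
  ... | v , m , e with words-AbsEq (words-equivariant _) (AbsEq-sym abs≡) m
  ...   | v' , m' , e' = br _ ∷ v' , beh⁺ (word-br p∈ m') , α-trans (α-cong _ e) e'

  word⇒path : ∀ n {q v} → beh 𝒬 n q ⊩ v → ∃[ q' ] Path 𝒬 q v q'
  word⇒path zero    ⊩-var = _ , p-nil
  word⇒path (suc n) m with beh⁻ m
  ... | word-nm p∈ m' with word⇒path n m'
  ...   | q' , path = q' , p-cons (step-nm p∈) path
  word⇒path (suc n) m | word-br p∈ m' with word⇒path n m'
  ...   | q' , path = q' , p-cons (step-br (_ , p∈ , AbsEq-refl Q _ _)) path

open Behaviour

-- Local freshness semantics against the order on words.

module _ (𝒬 𝒬' : FBRNTS) {x : Car (nom (St 𝒬))} {y : Car (nom (St 𝒬'))} where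

  D⊆⇒≲ : (∀ u → InD 𝒬 x u → InD 𝒬' y u) → ∀ n → beh 𝒬 n x ≲ beh 𝒬' n y
  -- The avoided names are fixed before `w` is known: they include the free names of any string
  -- α-equivalent to a depth `n` word of `y`.
  D⊆⇒≲ D⊆ n {v} m with cleanse (names (beh 𝒬' n y)) v
  ... | v̂ , clean , v≡v̂ with D⊆ (ub v̂) (v̂ , (v , word⇒path 𝒬 n m , α-sym v≡v̂) , refl)
  ...   | w , (p , (_ , path) , w≡p) , ub≡ with path⇒word 𝒬' path
  ...     | v₂ , m₂ , p≡v₂ = v₂ , m₂' , ⊑α-trans (α⇒⊑α v≡v̂) (w , v̂⊑w , w≡v₂)
    where
      w≡v₂ = α-trans w≡p p≡v₂
      -- The inclusion of languages says nothing about depth, so `n` is recovered from lengths,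
      -- which `ub` and `_≡α_` preserve.
      |p|≡n : length p ≡ n
      |p|≡n = trans (sym (α-length w≡p)) (trans (sym (length-map _ w)) (trans (cong length ub≡)
                (trans (length-map _ v̂) (trans (sym (α-length v≡v̂)) (⊩-length m)))))
      m₂' : beh 𝒬' n y ⊩ v₂
      m₂' = ≡.subst (λ k → beh 𝒬' k y ⊩ v₂) |p|≡n m₂
      v̂⊑w : v̂ ⊑ w
      v̂⊑w = clean⇒⊑ v̂ w clean (sym ub≡) (λ c → ⊩-names m₂' ∘ free⇒∈ub ∘ proj₁ (free-α w≡v₂))

  -- Adding bars to `w` leaves `ub w` unchanged, and the raised string belongs to the language of
  -- `y` because it is α-equivalent to one of its words.
  ≲⇒D⊆ : (∀ n → beh 𝒬 n x ≲ beh 𝒬' n y) → ∀ u → InD 𝒬 x u → InD 𝒬' y u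
  ≲⇒D⊆ x≲y u (w , (p , (_ , path) , w≡p) , refl) with path⇒word 𝒬 path
  ... | v , m , p≡v with x≲y (length p) m
  ...   | v₂ , m₂ , v⊑v₂ with ⊑α-trans (α⇒⊑α (α-trans w≡p p≡v)) v⊑v₂
  ...     | w' , w⊑w' , w'≡v₂ =
    w' , (v₂ , word⇒path 𝒬' (length p) m₂ , w'≡v₂) , sym (⊑-ub w⊑w')

theorem6 : (𝒬 𝒬' : FBRNTS) (x : Car (nom (St 𝒬))) (y : Car (nom (St 𝒬'))) →
    ((u : List Name) → (InD 𝒬 x u ⇔ InD 𝒬' y u))
    ⇔ ((n : ℕ) → Der OneN n (beh 𝒬 n x) (beh 𝒬' n y))
theorem6 𝒬 𝒬' x y = mk⇔
  (λ D≡ n → ≼-antisym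
    (≲⇒≼ _ _ (D⊆⇒≲ 𝒬 𝒬' (λ u → Equivalence.to (D≡ u)) n))
    (≲⇒≼ _ _ (D⊆⇒≲ 𝒬' 𝒬 (λ u → Equivalence.from (D≡ u)) n)))
  (λ der u → mk⇔
    (≲⇒D⊆ 𝒬 𝒬' (λ n → proj₁ (Der-sound (der n))) u)
    (≲⇒D⊆ 𝒬' 𝒬 (λ n → proj₂ (Der-sound (der n))) u))
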